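{- Let $(G,X,H,f)$ be a constructible configuration, let $B$ be a block of $G$, let $f^B$ be the $B$-part of $f$, and let $\mathfrak{C}^B=(B,X^B,H^B,f^B)$, where $X^B$ is the restriction of $X$ to $V(B)$ and $H^B=H[\bigcup_{v\in V(B)}X_v]$. Suppose that there is a pair $u,v$ of distinct vertices of $B$ such that $H(X_u,X_v)=H[X_u\cup X_v]$ has only one component. Then $\mathfrak{C}^B$ is an M-configuration, and if $u,v$ are (any) distinct vertices of $B$ with $\mu_G(u,v)=m>0$, then $H(X_u,X_v)$ is a $tK_{s,s}$ with $m=ts$ for some $s,t\in\mathbb{N}$.
   Context: $\mathbb{N}=\{1,2,\dots\}$, $\mathbb{N}_0=\mathbb{N}\cup\{0\}$. Graphs are finite, undirected, may have multiple edges, no loops; connected graphs are non-empty. $\mu_G(u,v)$ is the number of edges joining $u,v$; $d_G(v)$ is the number of edges incident with $v$. $tG$ has vertex set $V(G)$ and $\mu_{tG}=t\mu_G$. $K_n$, $C_n$ ($n\ge3$), $K_{s,s}$ are the simple complete graph, cycle, complete bipartite graph. A block of a graph is a maximal connected subgraph $B$ that has no separating vertex (vertex whose deletion from $B$ leaves at least two components); $G$ is a block if it is its own only block. Covers. A cover of $G$ is a pair $(X,H)$, $H$ a graph, $X$ assigning to each $v\in V(G)$ a set $X_v\subseteq V(H)$, such that the $X_v$ are pairwise disjoint with union $V(H)$, each $X_v$ is independent in $H$, and for distinct $u,v\in V(G)$ the set of edges of $H$ between $X_u$ and $X_v$ is the union of $\mu_G(u,v)$ (possibly empty) matchings. For $U\subseteq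 V(H)$ put $X_v(U)=X_v\cap U$; $(X,H)/U$ is the cover $(X',H[U])$ of $G[\{v: X_v(U)\ne\varnothing\}]$ with $X'_v=X_v(U)$. Configurations. A configuration is a tuple $(G,X,H,f)$ with $(X,H)$ a cover of the graph $G$ and $f:V(H)\to\mathbb{N}_0$. It is uniform if for some $r\ge1$ all $|X_v|=r$. Special covers (all up to renaming vertices of the cover graph). A $G$-cover is a cover with $X_v=\{x_v\}$ for all $v$ and $\mu_H(x_u,x_v)=\mu_G(u,v)$ for all distinct $u,v$. For $G=tC_n$ with $C_n=(v_1,\dots,v_n,v_1)$, a double $G$-cover is a cover with $X_{v_i}=\{x_i,x_{n+i}\}$ ($1\le i\le n$), $\mu_H(x_i,x_j)=t$ if $i-j\equiv\pm1 \pmod{2n}$ and $\mu_H(x_i,x_j)=0$ otherwise. If $s\in\mathbb{N}$ divides all multiplicities $\mu_H(x,y)$, the $s$-inflation of $(X,H)$ is the cover $(\tilde X,\tilde H)$ of $G$ obtained by replacing every $x\in V(H)$ by a set $U_x$ of $s$ new vertices, with $\tilde X_v=\bigcup_{x\in X_v}U_x$, and for distinct $x,y\in V(H)$ placing a copy of $mK_{s,s}$ with parts $U_x,U_y$, where $m=\mu_H(x,y)/s$. An inflation is an $s$-inflation for some $s\in\mathbb{N}$. Constructible configurations. The family of constructible configurations is defined recursively: a uniform configuration $(G,X,H,f)$ is constructible if one of the following holds. (K1) M-configuration: $G$ is a block and there is $U\subseteq V(H)$ such that $(X,H)/U$ is an inflation of a $G$-cover, and for $v\in V(G)$, $x\in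 X_v$: $f(x)=d_G(v)/|X_v(U)|$ if $x\in U$, else $f(x)=0$. (K2) K-configuration: $G=tK_n$ with $t,n\in\mathbb{N}$ and there are $p\ge1$, $n_1,\dots,n_p\in\mathbb{N}$ with $n_1+\dots+n_p=n-1$ and pairwise disjoint $U_1,\dots,U_p\subseteq V(H)$ such that each $(X,H)/U_i$ is an inflation of a $G$-cover, and for $v\in V(G)$, $x\in X_v$: $f(x)=tn_i/|X_v(U_i)|$ if $x\in U_i$ for some $i$, else $f(x)=0$. (K3) Odd C-configuration: $G=tC_n$ with $t\in\mathbb{N}$, $n\ge3$ odd, and there are disjoint $U_1,U_2\subseteq V(H)$ such that each $(X,H)/U_i$ is an inflation of a $G$-cover, and for $v\in V(G)$, $x\in X_v$: $f(x)=t/|X_v(U_i)|$ if $x\in U_i$ for $i\in\{1,2\}$, else $f(x)=0$. (K4) Even C-configuration: $G=tC_n$ with $t\in\mathbb{N}$, $n\ge4$ even, and there is $U\subseteq V(H)$ such that $(X,H)/U$ is an inflation of a double $G$-cover, and for $v\in V(G)$, $x\in X_v$: $f(x)=2t/|X_v(U)|$ if $x\in U$, else $f(x)=0$. (K5) There are two disjoint constructible configurations $(G^1,X^1,H^1,f^1)$, $(G^2,X^2,H^2,f^2)$ such that $G$ is obtained from the disjoint graphs $G^1,G^2$ by identifying a vertex $v^1\in V(G^1)$ and a vertex $v^2\in V(G^2)$ to a new vertex $v^*$; $H$ is obtained from the disjoint graphs $H^1,H^2$ by choosing a bijection $\pi:X^1_{v^1}\to X^2_{v^2}$ and identifying each $x\in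 X^1_{v^1}$ with $\pi(x)$ to a vertex $x^*$ (so $X_{v^*}$ is the set of these $x^*$, and $X_v=X^i_v$ for other $v\in V(G^i)$); and $f(y)=f^i(y)$ for $y\in V(H^i)\setminus X^i_{v^i}$, $f(x^*)=f^1(x)+f^2(\pi(x))$ for $x\in X^1_{v^1}$. A C-configuration is an odd or an even C-configuration. $B$-parts. For a constructible configuration $(G,X,H,f)$ there is a unique family of functions $f^B:V(H^B)\to\mathbb{N}_0$, indexed by the blocks $B$ of $G$, such that each $(B,X^B,H^B,f^B)$ is an M-, K- or C-configuration and $f(x)=\sum_{B\ni v}f^B(x)$ (sum over blocks $B$ containing $v$) for all $v\in V(G)$, $x\in X_v$; $f^B$ is called the $B$-part of $f$. -}

module Defs where

open import Algebra.Properties.CommutativeMonoid.Sum using (sum)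
open import Data.Bool using (Bool; true; false; T; if_then_else_; _∧_)
open import Data.Bool.Properties using (∧-comm)
open import Data.Fin using (Fin; toℕ; _↑ˡ_; _↑ʳ_)
open import Data.Fin.Properties using (any?)
open import Data.Fin.Subset using (Subset; _∈_; _∉_; _⊆_; _∩_; _∪_; _-_; ⁅_⁆; ∣_∣; Nonempty)
open import Data.Fin.Subset.Properties using (_∈?_; nonempty?; x∈p∩q⁺)
import Data.Integer as ℤ
import Data.Integer.Divisibility as ℤ
open import Data.Nat using (ℕ; _+_; _*_; _∸_; _≤_; _<_)
open import Data.Nat.Divisibility using (_∣_)
open import Data.Nat.Properties using (+-0-commutativeMonoid)
open import Data.Product using (Σ-syntax; ∃-syntax; _×_; _,_)
open import Data.Sum using (_⊎_)
open import Data.Vec using (tabulate; lookup)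
open import Data.Vec.Properties using (lookup⇒[]=)
open import Function.Bundles using (_⇔_)
open import Relation.Binary.Construct.Closure.ReflexiveTransitive using (Star)
open import Relation.Binary.PropositionalEquality using (_≡_; _≢_; refl; trans; cong)
open import Relation.Nullary using (¬_; does)
open import Relation.Nullary.Decidable using (_×-dec_)

private
  variable
    n n₁ n₂ m m₁ m₂ : ℕ

∑ : (Fin n → ℕ) → ℕ
∑ = sum +-0-commutativeMonoid

Disjoint : Subset n → Subset n → Set
Disjoint p q = ∀ {x} → x ∈ p → x ∉ q

------------------------------------------------------------------------
-- Multigraphs

-- The vertex set is a subset of an ambient Fin n, so that a graph and its
-- subgraphs live in the same type.
record Graph (n : ℕ) : Set where
  field
    V         : Subset n
    μ         : Fin n → Fin n → ℕ
    symmetric : ∀ x y → μ x y ≡ μ y x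
    loopless  : ∀ x → μ x x ≡ 0
    supported : ∀ x y → x ∉ V → μ x y ≡ 0

open Graph public

degree : Graph n → Fin n → ℕ
degree G v = ∑ (μ G v)

infix 4 _⊑_ _≈_

_⊑_ : Graph n → Graph n → Set
G ⊑ G′ = V G ⊆ V G′ × (∀ x y → μ G x y ≤ μ G′ x y)

_≈_ : Graph n → Graph n → Set
G ≈ G′ = V G ≡ V G′ × (∀ x y → μ G x y ≡ μ G′ x y)

infix 8 _[_]

_[_] : Graph n → Subset n → Graph n
_[_] {n} G S = record
  { V         = V G ∩ S
  ; μ         = μ′
  ; symmetric = λ x y → trans (cong (μ G x y when_) (∧-comm (lookup S x) (lookup S y)))
                              (cong (_when (lookup S y ∧ lookup S x)) (symmetric G x y))
  ; loopless  = λ x → when-zero (lookup S x ∧ lookup S x) (loopless G x)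
  ; supported = supported′
  }
  where
  _when_ : ℕ → Bool → ℕ
  k when b = if b then k else 0

  when-zero : ∀ {k} b → k ≡ 0 → k when b ≡ 0
  when-zero true  eq = eq
  when-zero false eq = refl

  μ′ : Fin n → Fin n → ℕ
  μ′ x y = μ G x y when (lookup S x ∧ lookup S y)

  supported′ : ∀ x y → x ∉ (V G ∩ S) → μ′ x y ≡ 0
  supported′ x y x∉ with lookup S x in eq
  ... | false = refl
  ... | true  = when-zero (lookup S y)
                  (supported G x y (λ x∈V → x∉ (x∈p∩q⁺ (x∈V , lookup⇒[]= x S eq))))

Adjacent : Graph n → Fin n → Fin n → Set
Adjacent G x y = 0 < μ G x y

-- Components are the classes of this relation on the vertex set.
SameComponent : Graph n → Fin n → Fin n → Set
SameComponent G = Star (Adjacent G)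

OneComponent : Graph n → Set
OneComponent G = Nonempty (V G) × (∀ {x y} → x ∈ V G → y ∈ V G → SameComponent G x y)

AtLeastTwoComponents : Graph n → Set
AtLeastTwoComponents G = ∃[ x ] ∃[ y ] (x ∈ V G × y ∈ V G × ¬ SameComponent G x y)

Connected : Graph n → Set
Connected = OneComponent

SeparatingVertex : Graph n → Fin n → Set
SeparatingVertex G v = v ∈ V G × AtLeastTwoComponents (G [ V G - v ])

ConnectedNoSeparatingVertex : Graph n → Set
ConnectedNoSeparatingVertex G = Connected G × (∀ v → ¬ SeparatingVertex G v)

record _IsBlockOf_ (B G : Graph n) : Set where
  field
    subgraph : B ⊑ G
    unsep    : ConnectedNoSeparatingVertex B
    maximal  : ∀ B′ → B′ ⊑ G → ConnectedNoSeparatingVertex B′ → B ⊑ B′ → B′ ≈ B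

IsBlock : Graph n → Set
IsBlock G = G IsBlockOf G × (∀ B → B IsBlockOf G → B ≈ G)

-- G = t K_k
IsMultipleComplete : ℕ → ℕ → Graph n → Set
IsMultipleComplete t k G =
  ∣ V G ∣ ≡ k × (∀ {u v} → u ∈ V G → v ∈ V G → u ≢ v → μ G u v ≡ t)

-- G = t K_{s,s}
record IsMultipleBiclique (t s : ℕ) (G : Graph n) : Set where
  field
    P Q      : Subset n
    disjoint : Disjoint P Q
    union    : V G ≡ P ∪ Q
    ∣P∣≡s    : ∣ P ∣ ≡ s
    ∣Q∣≡s    : ∣ Q ∣ ≡ s
    across   : ∀ {x y} → x ∈ P → y ∈ Q → μ G x y ≡ t
    insideP  : ∀ {x y} → x ∈ P → y ∈ P → μ G x y ≡ 0
    insideQ  : ∀ {x y} → x ∈ Q → y ∈ Q → μ G x y ≡ 0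

-- i - j ≡ ± 1 (mod k)
CyclicNeighbours : ∀ k → Fin k → Fin k → Set
CyclicNeighbours k i j =
  (ℤ.+ k) ℤ.∣ ((toℕ i ℤ.⊖ toℕ j) ℤ.- ℤ.1ℤ) ⊎ (ℤ.+ k) ℤ.∣ ((toℕ i ℤ.⊖ toℕ j) ℤ.+ ℤ.1ℤ)

-- An injective enumeration c of V(G) along which consecutive vertices,
-- cyclically, are joined by t edges.  It exhibits G as t C_k only if k ≥ 3;
-- that bound is imposed wherever this is used.
record CyclicEnumeration (t k : ℕ) (G : Graph n) : Set where
  field
    c           : Fin k → Fin n
    injective   : ∀ {i j} → c i ≡ c j → i ≡ j
    vertices    : ∀ v → v ∈ V G ⇔ (∃[ i ] v ≡ c i)
    adjacent    : ∀ i j → CyclicNeighbours k i j → μ G (c i) (c j) ≡ t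
    nonadjacent : ∀ i j → ¬ CyclicNeighbours k i j → μ G (c i) (c j) ≡ 0

------------------------------------------------------------------------
-- Covers

-- The triple of a graph and a would-be cover of it; X v is meaningful only
-- for v ∈ V G.
record CoverData (n m : ℕ) : Set where
  field
    G : Graph n
    X : Fin n → Subset m
    H : Graph m

open CoverData public

-- An edge of H with its ends in a chosen order; copy tells parallel edges
-- apart.
record Edge (H : Graph m) : Set where
  field
    end₁ end₂ : Fin m
    copy      : Fin (μ H end₁ end₂)

open Edge public

Between : {H : Graph m} → Subset m → Subset m → Edge H → Set
Between P Q e = end₁ e ∈ P × end₂ e ∈ Q

-- Only applied to sets of edges Between two disjoint vertex sets, where
-- two edges can share an end only on the same side.
IsMatching : (H : Graph m) → (Edge H → Bool) → Set
IsMatching H M = ∀ e e′ → T (M e) → T (M e′) → end₁ e ≡ end₁ e′ ⊎ end₂ e ≡ end₂ e′ → e ≡ e′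

UnionOfMatchings : (H : Graph m) → Subset m → Subset m → ℕ → Set
UnionOfMatchings H P Q k = Σ[ M ∈ (Fin k → Edge H → Bool) ]
  (∀ i → IsMatching H (M i)) ×
  (∀ e → Between P Q e ⇔ (∃[ i ] T (M i e)))

record IsCover (C : CoverData n m) : Set where
  field
    disjoint    : ∀ {u v} → u ∈ V (G C) → v ∈ V (G C) → u ≢ v → Disjoint (X C u) (X C v)
    union       : ∀ x → x ∈ V (H C) ⇔ (∃[ v ] (v ∈ V (G C) × x ∈ X C v))
    independent : ∀ {v x y} → v ∈ V (G C) → x ∈ X C v → y ∈ X C v → μ (H C) x y ≡ 0
    matchings   : ∀ {u v} → u ∈ V (G C) → v ∈ V (G C) → u ≢ v →
                  UnionOfMatchings (H C) (X C u) (X C v) (μ (G C) u v)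

infixl 7 _/_

_/_ : CoverData n m → Subset m → CoverData n m
C / U = record
  { G = G C [ tabulate (λ v → does (nonempty? (X C v ∩ U))) ]
  ; X = λ v → X C v ∩ U
  ; H = H C [ U ]
  }

-- C is a G-cover for G = G C
IsGCover : CoverData n m → Set
IsGCover {n} {m} C = IsCover C × Σ[ x ∈ (Fin n → Fin m) ]
  (∀ {v} → v ∈ V (G C) → X C v ≡ ⁅ x v ⁆) ×
  (∀ {u v} → u ∈ V (G C) → v ∈ V (G C) → u ≢ v → μ (H C) (x u) (x v) ≡ μ (G C) u v)

-- C is a double G-cover for G = G C = t C_k; the cover vertices x_i and
-- x_{k+i} over c i are x (i ↑ˡ k) and x (k ↑ʳ i).
record IsDoubleCover (t k : ℕ) (C : CoverData n m) : Set where
  field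
    isCover     : IsCover C
    cycle       : CyclicEnumeration t k (G C)
    x           : Fin (k + k) → Fin m
    injective   : ∀ {i j} → x i ≡ x j → i ≡ j
    fibre       : ∀ i → X C (CyclicEnumeration.c cycle i) ≡ ⁅ x (i ↑ˡ k) ⁆ ∪ ⁅ x (k ↑ʳ i) ⁆
    adjacent    : ∀ i j → CyclicNeighbours (k + k) i j → μ (H C) (x i) (x j) ≡ t
    nonadjacent : ∀ i j → ¬ CyclicNeighbours (k + k) i j → μ (H C) (x i) (x j) ≡ 0

-- C̃ is (up to renaming) the s-inflation of C.
record IsInflationBy (s : ℕ) (C : CoverData n m₁) (C̃ : CoverData n m₂) : Set where
  field
    s≥1      : 1 ≤ s
    divides  : ∀ x y → s ∣ μ (H C) x y
    sameBase : G C̃ ≈ G C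
    U        : Fin m₁ → Subset m₂
    size     : ∀ {x} → x ∈ V (H C) → ∣ U x ∣ ≡ s
    disjoint : ∀ {x y} → x ∈ V (H C) → y ∈ V (H C) → x ≢ y → Disjoint (U x) (U y)
    vertices : ∀ a → a ∈ V (H C̃) ⇔ (∃[ x ] (x ∈ V (H C) × a ∈ U x))
    fibres   : ∀ {v} → v ∈ V (G C) → ∀ a → a ∈ X C̃ v ⇔ (∃[ x ] (x ∈ X C v × a ∈ U x))
    across   : ∀ {x y a b} → x ∈ V (H C) → y ∈ V (H C) → x ≢ y → a ∈ U x → b ∈ U y →
               μ (H C̃) a b * s ≡ μ (H C) x y
    inside   : ∀ {x a b} → x ∈ V (H C) → a ∈ U x → b ∈ U x → μ (H C̃) a b ≡ 0

IsInflation : CoverData n m₁ → CoverData n m₂ → Set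
IsInflation C C̃ = ∃[ s ] IsInflationBy s C C̃

-- C̃ is an inflation of a G-cover.
IsInflatedGCover : Graph n → CoverData n m → Set
IsInflatedGCover {n} G₀ C̃ =
  ∃[ m₀ ] Σ[ C ∈ CoverData n m₀ ] (G C ≈ G₀ × IsGCover C × IsInflation C C̃)

-- C̃ is an inflation of a double G-cover, where G = t C_k.
IsInflatedDoubleCover : ℕ → ℕ → Graph n → CoverData n m → Set
IsInflatedDoubleCover {n} t k G₀ C̃ =
  ∃[ m₀ ] Σ[ C ∈ CoverData n m₀ ] (G C ≈ G₀ × IsDoubleCover t k C × IsInflation C C̃)

------------------------------------------------------------------------
-- Configurations

-- f x is meaningful only for x ∈ V (H cover).
record ConfigurationData (n m : ℕ) : Set where
  constructor _,_
  field
    cover : CoverData n m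
    f     : Fin m → ℕ

open ConfigurationData public

record IsUniformConfiguration (𝔠 : ConfigurationData n m) : Set where
  field
    isCover : IsCover (cover 𝔠)
    r       : ℕ
    r≥1     : 1 ≤ r
    uniform : ∀ {v} → v ∈ V (G (cover 𝔠)) → ∣ X (cover 𝔠) v ∣ ≡ r

-- f(x) = a / |X_v(U)| for all v ∈ V(G) and x ∈ X_v ∩ U, with the (nonzero)
-- denominator cleared.
ValueOn : ConfigurationData n m → Subset m → (Fin n → ℕ) → Set
ValueOn 𝔠 U a = ∀ {v x} → v ∈ V (G C) → x ∈ X C v → x ∈ U → f 𝔠 x * ∣ X C v ∩ U ∣ ≡ a v
  where C = cover 𝔠

record IsMConfiguration (𝔠 : ConfigurationData n m) : Set where
  private C = cover 𝔠
  field
    isUniform : IsUniformConfiguration 𝔠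
    isBlock   : IsBlock (G C)
    U         : Subset m
    U⊆V       : U ⊆ V (H C)
    inflation : IsInflatedGCover (G C) (C / U)
    f-on      : ValueOn 𝔠 U (degree (G C))
    f-off     : ∀ {x} → x ∈ V (H C) → x ∉ U → f 𝔠 x ≡ 0

record IsKConfiguration (𝔠 : ConfigurationData n m) : Set where
  private C = cover 𝔠
  field
    isUniform : IsUniformConfiguration 𝔠
    t k       : ℕ
    t≥1       : 1 ≤ t
    k≥1       : 1 ≤ k
    complete  : IsMultipleComplete t k (G C)
    p         : ℕ
    p≥1       : 1 ≤ p
    part      : Fin p → ℕ
    part≥1    : ∀ i → 1 ≤ part i
    sum-part  : ∑ part ≡ k ∸ 1
    U         : Fin p → Subset m
    U⊆V       : ∀ i → U i ⊆ V (H C)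
    disjoint  : ∀ i j → i ≢ j → Disjoint (U i) (U j)
    inflation : ∀ i → IsInflatedGCover (G C) (C / U i)
    f-on      : ∀ i → ValueOn 𝔠 (U i) (λ _ → t * part i)
    f-off     : ∀ {x} → x ∈ V (H C) → (∀ i → x ∉ U i) → f 𝔠 x ≡ 0

record IsOddCConfiguration (𝔠 : ConfigurationData n m) : Set where
  private C = cover 𝔠
  field
    isUniform  : IsUniformConfiguration 𝔠
    t k        : ℕ
    t≥1        : 1 ≤ t
    k≥3        : 3 ≤ k
    odd        : ¬ (2 ∣ k)
    cycle      : CyclicEnumeration t k (G C)
    U₁ U₂      : Subset m
    U₁⊆V       : U₁ ⊆ V (H C)
    U₂⊆V       : U₂ ⊆ V (H C)
    disjoint   : Disjoint U₁ U₂
    inflation₁ : IsInflatedGCover (G C) (C / U₁)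
    inflation₂ : IsInflatedGCover (G C) (C / U₂)
    f-on₁      : ValueOn 𝔠 U₁ (λ _ → t)
    f-on₂      : ValueOn 𝔠 U₂ (λ _ → t)
    f-off      : ∀ {x} → x ∈ V (H C) → x ∉ U₁ → x ∉ U₂ → f 𝔠 x ≡ 0

record IsEvenCConfiguration (𝔠 : ConfigurationData n m) : Set where
  private C = cover 𝔠
  field
    isUniform : IsUniformConfiguration 𝔠
    t k       : ℕ
    t≥1       : 1 ≤ t
    k≥4       : 4 ≤ k
    even      : 2 ∣ k
    cycle     : CyclicEnumeration t k (G C)
    U         : Subset m
    U⊆V       : U ⊆ V (H C)
    inflation : IsInflatedDoubleCover t k (G C) (C / U)
    f-on      : ValueOn 𝔠 U (λ _ → 2 * t)
    f-off     : ∀ {x} → x ∈ V (H C) → x ∉ U → f 𝔠 x ≡ 0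

data IsMKCConfiguration (𝔠 : ConfigurationData n m) : Set where
  M-conf  : IsMConfiguration 𝔠 → IsMKCConfiguration 𝔠
  K-conf  : IsKConfiguration 𝔠 → IsMKCConfiguration 𝔠
  Cᵒ-conf : IsOddCConfiguration 𝔠 → IsMKCConfiguration 𝔠
  Cᵉ-conf : IsEvenCConfiguration 𝔠 → IsMKCConfiguration 𝔠

-- G is (up to renaming) obtained from disjoint copies of G₁ and G₂ by
-- identifying a with b whenever R a b; j₁ and j₂ send each vertex to its
-- image in G.  In both uses below R is a bijection between an independent
-- set of G₁ and one of G₂, so the clauses on μ agree on identified vertices.
record IsIdentification (G₁ : Graph n₁) (G₂ : Graph n₂) (G : Graph n)
                        (R : Fin n₁ → Fin n₂ → Set) : Set where
  field
    j₁         : Fin n₁ → Fin n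
    j₂         : Fin n₂ → Fin n
    injective₁ : ∀ {a b} → a ∈ V G₁ → b ∈ V G₁ → j₁ a ≡ j₁ b → a ≡ b
    injective₂ : ∀ {a b} → a ∈ V G₂ → b ∈ V G₂ → j₂ a ≡ j₂ b → a ≡ b
    identified : ∀ {a b} → a ∈ V G₁ → b ∈ V G₂ → j₁ a ≡ j₂ b ⇔ R a b
    vertices   : ∀ w → w ∈ V G ⇔ ((∃[ a ] (a ∈ V G₁ × w ≡ j₁ a)) ⊎ (∃[ b ] (b ∈ V G₂ × w ≡ j₂ b)))
    edges₁     : ∀ {a b} → a ∈ V G₁ → b ∈ V G₁ → μ G (j₁ a) (j₁ b) ≡ μ G₁ a b
    edges₂     : ∀ {a b} → a ∈ V G₂ → b ∈ V G₂ → μ G (j₂ a) (j₂ b) ≡ μ G₂ a b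
    cross      : ∀ {a b} → a ∈ V G₁ → b ∈ V G₂ →
                 (∀ {b′} → b′ ∈ V G₂ → ¬ R a b′) → (∀ {a′} → a′ ∈ V G₁ → ¬ R a′ b) →
                 μ G (j₁ a) (j₂ b) ≡ 0

record IsGluing (𝔠₁ : ConfigurationData n₁ m₁) (𝔠₂ : ConfigurationData n₂ m₂)
                (𝔠 : ConfigurationData n m) : Set where
  private
    C  = cover 𝔠
    C₁ = cover 𝔠₁
    C₂ = cover 𝔠₂
  field
    v₁     : Fin n₁
    v₂     : Fin n₂
    v₁∈V   : v₁ ∈ V (G C₁)
    v₂∈V   : v₂ ∈ V (G C₂)
    glueG  : IsIdentification (G C₁) (G C₂) (G C) (λ a b → a ≡ v₁ × b ≡ v₂)
    π      : Fin m₁ → Fin m₂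
    π-into : ∀ {x} → x ∈ X C₁ v₁ → π x ∈ X C₂ v₂
    π-inj  : ∀ {x y} → x ∈ X C₁ v₁ → y ∈ X C₁ v₁ → π x ≡ π y → x ≡ y
    π-surj : ∀ {y} → y ∈ X C₂ v₂ → ∃[ x ] (x ∈ X C₁ v₁ × π x ≡ y)
    glueH  : IsIdentification (H C₁) (H C₂) (H C) (λ x y → x ∈ X C₁ v₁ × y ≡ π x)

  open IsIdentification glueG public using (j₁; j₂)
  open IsIdentification glueH public using () renaming (j₁ to i₁; j₂ to i₂)

  field
    fibre₁ : ∀ {a} → a ∈ V (G C₁) → ∀ y → y ∈ X C (j₁ a) ⇔ (∃[ x ] (x ∈ X C₁ a × y ≡ i₁ x))
    fibre₂ : ∀ {a} → a ∈ V (G C₂) → ∀ y → y ∈ X C (j₂ a) ⇔ (∃[ x ] (x ∈ X C₂ a × y ≡ i₂ x))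
    f-rest₁ : ∀ {y} → y ∈ V (H C₁) → y ∉ X C₁ v₁ → f 𝔠 (i₁ y) ≡ f 𝔠₁ y
    f-rest₂ : ∀ {y} → y ∈ V (H C₂) → y ∉ X C₂ v₂ → f 𝔠 (i₂ y) ≡ f 𝔠₂ y
    f-glued : ∀ {x} → x ∈ X C₁ v₁ → f 𝔠 (i₁ x) ≡ f 𝔠₁ x + f 𝔠₂ (π x)

data Constructible {n m : ℕ} (𝔠 : ConfigurationData n m) : Set where
  basic : IsMKCConfiguration 𝔠 → Constructible 𝔠
  glued : ∀ {n₁ n₂ m₁ m₂}
          {𝔠₁ : ConfigurationData n₁ m₁} {𝔠₂ : ConfigurationData n₂ m₂} →
          IsUniformConfiguration 𝔠 → Constructible 𝔠₁ → Constructible 𝔠₂ →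
          IsGluing 𝔠₁ 𝔠₂ 𝔠 → Constructible 𝔠

------------------------------------------------------------------------
-- B-parts

-- ⋃_{v ∈ S} X_v
fibresOver : (Fin n → Subset m) → Subset n → Subset m
fibresOver X S = tabulate (λ x → does (any? (λ v → (v ∈? S) ×-dec (x ∈? X v))))

-- (B, X^B, H^B); X^B is X, whose values outside V(B) become irrelevant.
restrict : CoverData n m → Graph n → CoverData n m
restrict C B = record
  { G = B
  ; X = X C
  ; H = H C [ fibresOver (X C) (V B) ]
  }

-- A family (f^B) indexed by the blocks B of G, presented along a
-- repetition-free enumeration of these blocks.
record IsBlockDecomposition (𝔠 : ConfigurationData n m) (k : ℕ)
                            (block : Fin k → Graph n) (part : Fin k → Fin m → ℕ) : Set where
  private C = cover 𝔠
  field
    isBlock  : ∀ i → block i IsBlockOf G C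
    distinct : ∀ {i j} → block i ≈ block j → i ≡ j
    complete : ∀ B → B IsBlockOf G C → ∃[ i ] block i ≈ B
    partKind : ∀ i → IsMKCConfiguration (restrict C (block i) , part i)
    partSum  : ∀ {v x} → v ∈ V (G C) → x ∈ X C v →
               f 𝔠 x ≡ ∑ (λ i → if does (v ∈? V (block i)) then part i x else 0)

-- fᴮ is the B-part of f; such families exist and are unique when 𝔠 is
-- constructible.
IsBlockPart : ConfigurationData n m → Graph n → (Fin m → ℕ) → Set
IsBlockPart {n} {m} 𝔠 B fᴮ =
  ∃[ k ] Σ[ block ∈ (Fin k → Graph n) ] Σ[ part ∈ (Fin k → Fin m → ℕ) ]
  (IsBlockDecomposition 𝔠 k block part ×
   (∃[ i ] (block i ≈ B ×
            (∀ {x} → x ∈ V (H (restrict (cover 𝔠) B)) → fᴮ x ≡ part i x))))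

{-# OPTIONS --safe #-}
module Submission where

-- The edges between X_u and X_v form μ(u,v) matchings, so a vertex of X_u sends
-- at most μ(u,v) edges to X_v.  If (X,H)/U is an inflation of a G-cover, then a
-- vertex of X_u ∩ U already sends μ(u,v) edges to X_v ∩ U; hence U meets
-- X_u ∪ X_v in a union of components of H[X_u ∪ X_v].  If this graph has only
-- one component, then X_u ⊆ U, and by uniformity U contains every fibre.  So
-- there cannot be two disjoint sets U, which excludes odd C-configurations and
-- leaves p = 1 for K-configurations, and these are M-configurations.  In an
-- inflated double cover the same count shows that each inflated edge is a
-- component, so even C-configurations are excluded as well.

open import Defs
open import Data.Bool using (Bool; true; false; T; _∧_; if_then_else_)
open import Data.Empty using (⊥; ⊥-elim)
open import Data.Fin using (Fin; zero; suc; toℕ; _↑ˡ_; _↑ʳ_; splitAt)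
open import Data.Fin.Properties using (injective⇒≤; join-splitAt; toℕ-↑ˡ; toℕ-↑ʳ; toℕ<n)
open import Data.Fin.Subset using (Subset; inside; outside; _∈_; _∉_; _⊆_; _∩_; _∪_; _-_; ∣_∣; Nonempty) renaming (⊥ to ∅)
open import Data.Fin.Subset.Properties using (_∈?_; drop-there; x∈⁅x⁆; x∈⁅y⁆⇒x≡y; x∈p∩q⁺; x∈p∩q⁻; x∈p∪q⁺; x∈p∪q⁻; ∪-comm; p∩q⊆p; p∩q⊆q; ⊆-antisym; p⊂q⇒∣p∣<∣q∣; ∉⊥; ∣⊥∣≡0; Empty-unique; nonempty?)
open import Data.Integer as ℤ using (ℤ; _⊖_)
open import Data.Integer.DivMod using (_%ℕ_; _/ℕ_; a≡a%ℕn+[a/ℕn]*n; n%ℕd<d)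
open import Data.Integer.Divisibility using () renaming (_∣_ to _∣ᵤ_)
open import Data.Integer.Divisibility.Signed using (∣⇒∣ᵤ; ∣ᵤ⇒∣) renaming (_∣_ to _∣ˢ_; divides to dividesˢ)
open import Data.Integer.Properties using ([+m]-[+n]≡m⊖n)
open import Data.Integer.Tactic.RingSolver using (solve-∀)
open import Data.Nat using (ℕ; zero; suc; _+_; _*_; _≤_; _<_; z≤n; s≤s; >-nonZero)
open import Data.Nat.Divisibility using (divides)
open import Data.Nat.Properties
open import Algebra.Properties.CommutativeMonoid.Sum +-0-commutativeMonoid using (sum-cong-≗)
open import Data.Product using (Σ; _×_; _,_; proj₁; proj₂; ∃-syntax)
open import Data.Sum as Sum using (_⊎_; inj₁; inj₂)
open import Data.Vec using ([]; _∷_; lookup; here; there)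
open import Data.Vec.Properties using (lookup⇒[]=; []=⇒lookup)
open import Function using (_∘_)
open import Function.Bundles using (Equivalence)
open import Relation.Binary.Construct.Closure.ReflexiveTransitive as Star using (Star; ε; _◅_)
open import Relation.Binary.PropositionalEquality using (_≡_; _≢_; refl; sym; trans; cong; cong₂; subst; subst₂)
open import Relation.Nullary using (¬_; yes; no; contradiction)

open Equivalence using (to; from)

private
  variable
    n m m₀ s t k : ℕ

-- Finite sums

∑-mono-≤ : {g h : Fin n → ℕ} → (∀ x → g x ≤ h x) → ∑ g ≤ ∑ h
∑-mono-≤ {zero}  g≤h = z≤n
∑-mono-≤ {suc n} g≤h = +-mono-≤ (g≤h zero) (∑-mono-≤ (g≤h ∘ suc))

∑-mono-< : {g h : Fin n → ℕ} → (∀ x → g x ≤ h x) → ∀ x → g x < h x → ∑ g < ∑ h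
∑-mono-< g≤h zero    g<h = +-mono-<-≤ g<h (∑-mono-≤ (g≤h ∘ suc))
∑-mono-< g≤h (suc x) g<h = +-mono-≤-< (g≤h zero) (∑-mono-< (g≤h ∘ suc) x g<h)

∑-constant-on : (p : Subset n) {g : Fin n → ℕ} →
                (∀ {x} → x ∈ p → g x ≡ t) → (∀ {x} → x ∉ p → g x ≡ 0) → ∑ g ≡ ∣ p ∣ * t
∑-constant-on []            on off = refl
∑-constant-on (inside  ∷ p) on off =
  cong₂ _+_ (on here) (∑-constant-on p (on ∘ there) (λ x∉p → off (x∉p ∘ drop-there)))
∑-constant-on (outside ∷ p) on off =
  cong₂ _+_ (off (λ ())) (∑-constant-on p (on ∘ there) (λ x∉p → off (x∉p ∘ drop-there)))

-- The exceptional `v` contributes 0 where a constant sum would have `t`; the missing `t` stands on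
-- the left to avoid truncated subtraction. This serves for degrees in multiples of complete graphs.
∑-constant-on-but : {p : Subset n} {g : Fin n → ℕ} {v : Fin n} → v ∈ p → g v ≡ 0 →
                    (∀ {x} → x ∈ p → x ≢ v → g x ≡ t) → (∀ {x} → x ∉ p → g x ≡ 0) →
                    t + ∑ g ≡ ∣ p ∣ * t
∑-constant-on-but {t = t} {p = inside ∷ p} here gv on off =
  cong (t +_) (cong₂ _+_ gv (∑-constant-on p (λ x∈p → on (there x∈p) (λ ()))
                                             (λ x∉p → off (x∉p ∘ drop-there))))
∑-constant-on-but {t = t} {p = inside ∷ p} {g} (there v∈p) gv on off =
  cong (t +_) (trans (cong (_+ ∑ (g ∘ suc)) (on here (λ ())))
    (∑-constant-on-but v∈p gv (λ x∈p x≢v → on (there x∈p) (λ { refl → x≢v refl }))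
                              (λ x∉p → off (x∉p ∘ drop-there))))
∑-constant-on-but {t = t} {p = outside ∷ p} {g} (there v∈p) gv on off =
  trans (cong (λ z → t + (z + ∑ (g ∘ suc))) (off (λ ())))
    (∑-constant-on-but v∈p gv (λ x∈p x≢v → on (there x∈p) (λ { refl → x≢v refl }))
                              (λ x∉p → off (x∉p ∘ drop-there)))

-- With its left inverse `pair`, this injects the indices below a sum into the disjoint union of the
-- terms, so that a bound on a degree can be proved by an injection.
unpair : (g : Fin n → ℕ) → Fin (∑ g) → Σ (Fin n) (Fin ∘ g)
unpair {suc n} g i with splitAt (g zero) i
... | inj₁ c = zero , c
... | inj₂ j = let b , c = unpair (g ∘ suc) j in suc b , c

pair : (g : Fin n → ℕ) → Σ (Fin n) (Fin ∘ g) → Fin (∑ g)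
pair g (zero  , c) = c ↑ˡ ∑ (g ∘ suc)
pair g (suc b , c) = g zero ↑ʳ pair (g ∘ suc) (b , c)

pair-unpair : (g : Fin n → ℕ) (i : Fin (∑ g)) → pair g (unpair g i) ≡ i
pair-unpair {suc n} g i with splitAt (g zero) i | join-splitAt (g zero) (∑ (g ∘ suc)) i
... | inj₁ c | eq = eq
... | inj₂ j | eq = trans (cong (g zero ↑ʳ_) (pair-unpair (g ∘ suc) j)) eq

-- Subsets

Nonempty-∣∣ : {p : Subset n} → ∣ p ∣ ≡ s → 1 ≤ s → Nonempty p
Nonempty-∣∣ {n} {p = p} size s≥1 with nonempty? p
... | yes ne = ne
... | no ¬ne = contradiction (trans (sym size) (trans (cong ∣_∣ (Empty-unique ¬ne)) (∣⊥∣≡0 n)))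
                             (λ s≡0 → <⇒≢ s≥1 (sym s≡0))

∣∩∣≡⇒⊆ : (p q : Subset n) → ∣ p ∩ q ∣ ≡ ∣ p ∣ → p ⊆ q
∣∩∣≡⇒⊆ p q eq {x} x∈p with x ∈? q
... | yes x∈q = x∈q
... | no  x∉q = contradiction eq (<⇒≢ (p⊂q⇒∣p∣<∣q∣ (p∩q⊆p p q , x , x∈p , x∉q ∘ p∩q⊆q p q)))

⊆⇒∩≡ : {p q : Subset n} → p ⊆ q → p ∩ q ≡ p
⊆⇒∩≡ {p = p} {q} p⊆q = ⊆-antisym (p∩q⊆p p q) (λ x∈p → x∈p∩q⁺ (x∈p , p⊆q x∈p))

-- Subgraphs

module _ (K : Graph n) {S : Subset n} where

  μ-[]-inside : ∀ {x y} → x ∈ S → y ∈ S → μ (K [ S ]) x y ≡ μ K x y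
  μ-[]-inside x∈S y∈S rewrite []=⇒lookup x∈S | []=⇒lookup y∈S = refl

  Adjacent-[]⁻ : ∀ {x y} → Adjacent (K [ S ]) x y → x ∈ S × y ∈ S × Adjacent K x y
  Adjacent-[]⁻ {x} {y} adj with lookup S x in eqx | lookup S y in eqy
  ... | true | true = lookup⇒[]= x S eqx , lookup⇒[]= y S eqy , adj

  Adjacent-[]⁺ : ∀ {x y} → x ∈ S → y ∈ S → Adjacent K x y → Adjacent (K [ S ]) x y
  Adjacent-[]⁺ x∈S y∈S = subst (0 <_) (sym (μ-[]-inside x∈S y∈S))

¬Adjacent : (K : Graph n) → ∀ {x y} → μ K x y ≡ 0 → ¬ Adjacent K x y
¬Adjacent K eq adj = <⇒≢ adj (sym eq)

≈-sym : {K L : Graph n} → K ≈ L → L ≈ K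
≈-sym (V≡ , μ≡) = sym V≡ , λ x y → sym (μ≡ x y)

≈-trans : {K L M : Graph n} → K ≈ L → L ≈ M → K ≈ M
≈-trans (V≡ , μ≡) (V≡′ , μ≡′) = trans V≡ V≡′ , λ x y → trans (μ≡ x y) (μ≡′ x y)

⊑-antisym : {K L : Graph n} → K ⊑ L → L ⊑ K → K ≈ L
⊑-antisym (V⊆ , μ≤) (V⊇ , μ≥) = ⊆-antisym V⊆ V⊇ , λ x y → ≤-antisym (μ≤ x y) (μ≥ x y)

≈-[] : {K L : Graph n} (S : Subset n) → K ≈ L → K [ S ] ≈ L [ S ]
≈-[] S (V≡ , μ≡) = cong (_∩ S) V≡ , λ x y → cong (λ z → if lookup S x ∧ lookup S y then z else 0) (μ≡ x y)

-- A property inherited by neighbours persists along every walk, and in a graph with one component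
-- walks reach every vertex.
spread : {K : Graph n} → OneComponent K → (P : Fin n → Set) →
         (∀ {x y} → P x → Adjacent K x y → P y) →
         ∀ {x y} → x ∈ V K → P x → y ∈ V K → P y
spread {K = K} (_ , joined) P closed x∈V Px y∈V = walk Px (joined x∈V y∈V)
  where
  walk : ∀ {x y} → P x → SameComponent K x y → P y
  walk Px ε            = Px
  walk Px (adj ◅ path) = walk (closed Px adj) path

-- Blocks

-- Extra edges on the same vertices preserve every walk, also after a vertex is deleted. Hence
-- vertices apart in `L` minus `v` are already apart in `K` minus `v`.
ConnectedNoSeparatingVertex-mono : {K L : Graph n} → K ⊑ L → V L ⊆ V K →
  ConnectedNoSeparatingVertex K → ConnectedNoSeparatingVertex L
ConnectedNoSeparatingVertex-mono {n} {K} {L} (V⊆ , μ≤) V⊇ (((x , x∈V) , joined) , noSep) =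
  ((x , V⊆ x∈V) , λ y∈V z∈V → Star.map adjacent (joined (V⊇ y∈V) (V⊇ z∈V))) ,
  λ { v (v∈V , y , z , y∈ , z∈ , apart) →
      noSep v (V⊇ v∈V , y , z , shrink y∈ , shrink z∈ , apart ∘ Star.map (adjacent′ v)) }
  where
  adjacent : ∀ {x y} → Adjacent K x y → Adjacent L x y
  adjacent {x} {y} adj = <-≤-trans adj (μ≤ x y)

  V≡ : V K ≡ V L
  V≡ = ⊆-antisym V⊆ V⊇

  adjacent′ : ∀ v {x y} → Adjacent (K [ V K - v ]) x y → Adjacent (L [ V L - v ]) x y
  adjacent′ v adj = let x∈ , y∈ , adjK = Adjacent-[]⁻ K adj in
    Adjacent-[]⁺ L (subst (λ W → _ ∈ W - v) V≡ x∈) (subst (λ W → _ ∈ W - v) V≡ y∈) (adjacent adjK)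

  shrink : ∀ {v y} → y ∈ V (L [ V L - v ]) → y ∈ V (K [ V K - v ])
  shrink {v} = subst (λ W → _ ∈ W ∩ (W - v)) (sym V≡)

-- The induced graph `G [ V B ]` arises from `B` by adding edges only, so it too is connected
-- without a separating vertex, and maximality of `B` makes the two agree.
block-induced : {B G : Graph n} → B IsBlockOf G → ∀ {u v} → u ∈ V B → v ∈ V B → μ B u v ≡ μ G u v
block-induced {n} {B} {G} isBlock {u} {v} u∈B v∈B =
  trans (sym (proj₂ G[B]≈B u v)) (μ-[]-inside G u∈B v∈B)
  where
  open _IsBlockOf_ isBlock

  μB≤ : ∀ x y → μ B x y ≤ μ (G [ V B ]) x y
  μB≤ x y with x ∈? V B | y ∈? V B
  ... | no x∉  | _      = subst (_≤ _) (sym (supported B x y x∉)) z≤n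
  ... | yes _  | no y∉  = subst (_≤ _) (sym (trans (symmetric B x y) (supported B y x y∉))) z≤n
  ... | yes x∈ | yes y∈ = subst (μ B x y ≤_) (sym (μ-[]-inside G x∈ y∈)) (proj₂ subgraph x y)

  μ[]≤ : ∀ x y → μ (G [ V B ]) x y ≤ μ G x y
  μ[]≤ x y with x ∈? V B | y ∈? V B
  ... | yes x∈ | yes y∈ = ≤-reflexive (μ-[]-inside G x∈ y∈)
  ... | no x∉  | _      = subst (_≤ _) (sym (supported (G [ V B ]) x y (x∉ ∘ p∩q⊆q (V G) (V B)))) z≤n
  ... | yes _  | no y∉  =
    subst (_≤ _) (sym (trans (symmetric (G [ V B ]) x y)
                             (supported (G [ V B ]) y x (y∉ ∘ p∩q⊆q (V G) (V B))))) z≤n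

  B⊑G[B] : B ⊑ G [ V B ]
  B⊑G[B] = (λ x∈ → x∈p∩q⁺ (proj₁ subgraph x∈ , x∈)) , μB≤

  G[B]≈B : G [ V B ] ≈ B
  G[B]≈B = maximal (G [ V B ]) (p∩q⊆p (V G) (V B) , μ[]≤)
             (ConnectedNoSeparatingVertex-mono {K = B} {L = G [ V B ]} B⊑G[B] (p∩q⊆q (V G) (V B)) unsep) B⊑G[B]

-- A block of `B` lies inside `B`, which is itself connected without a separating vertex; maximality
-- of the smaller one forces equality.
block⇒IsBlock : {B G : Graph n} → B IsBlockOf G → IsBlock B
block⇒IsBlock {B = B} isBlock =
  record { subgraph = B⊑B
         ; unsep    = unsep
         ; maximal  = λ B′ B′⊑B _ B⊑B′ → ⊑-antisym {K = B′} {L = B} B′⊑B B⊑B′ } ,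
  λ B′ isBlock′ → ≈-sym {K = B} {L = B′} (_IsBlockOf_.maximal isBlock′ B B⊑B unsep (_IsBlockOf_.subgraph isBlock′))
  where
  open _IsBlockOf_ isBlock
  B⊑B : B ⊑ B
  B⊑B = (λ x∈ → x∈) , λ _ _ → ≤-refl

-- Matchings

module _ {H : Graph m} {P Q : Subset m} (union : UnionOfMatchings H P Q k) {a : Fin m} (a∈P : a ∈ P) where
  private
    M        = proj₁ union
    matching = proj₁ (proj₂ union)
    covered  = proj₂ (proj₂ union)

    -- The Boolean stands for `lookup Q b`; as a separate argument it can be matched on when an edge
    -- is built from an element of `Fin (mult q b)`.
    mult : Bool → Fin m → ℕ
    mult q b = if q then μ H a b else 0

    edge : ∀ b q → Fin (mult q b) → Edge H
    edge b true c = record { end₁ = a ; end₂ = b ; copy = c }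

    edge-end₁ : ∀ b q c → end₁ (edge b q c) ≡ a
    edge-end₁ b true c = refl

    edge-end₂ : ∀ b q c → end₂ (edge b q c) ≡ b
    edge-end₂ b true c = refl

    edge-between : ∀ b c → Between P Q (edge b (lookup Q b) c)
    edge-between b c with lookup Q b in eq
    ... | true = a∈P , lookup⇒[]= b Q eq

    edge-injective : ∀ b q {c c′} → edge b q c ≡ edge b q c′ → c ≡ c′
    edge-injective b true refl = refl

    g : Fin m → ℕ
    g b = mult (lookup Q b) b

    colour : Σ (Fin m) (Fin ∘ g) → Fin k
    colour (b , c) = proj₁ (to (covered (edge b (lookup Q b) c)) (edge-between b c))

    -- Edges of the same colour lie in one matching and share the end `a`, so they coincide.
    colour-injective : ∀ p p′ → colour p ≡ colour p′ → p ≡ p′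
    colour-injective (b , c) (b′ , c′) eq = conclude b≡b′ edge≡edge
      where
      e  = edge b (lookup Q b) c
      e′ = edge b′ (lookup Q b′) c′

      edge≡edge : e ≡ e′
      edge≡edge = matching _ e e′
        (proj₂ (to (covered (edge b (lookup Q b) c)) (edge-between b c)))
        (subst (λ i → T (M i e′)) (sym eq) (proj₂ (to (covered e′) (edge-between b′ c′))))
        (inj₁ (trans (edge-end₁ b _ c) (sym (edge-end₁ b′ _ c′))))

      b≡b′ : b ≡ b′
      b≡b′ = trans (sym (edge-end₂ b _ c)) (trans (cong end₂ edge≡edge) (edge-end₂ b′ _ c′))

      -- The far ends have to be identified first: only then do the copies `c` and `c′` have the
      -- same type.
      conclude : b ≡ b′ → e ≡ e′ → (b , c) ≡ (b′ , c′)
      conclude refl e≡e′ = cong (b ,_) (edge-injective b (lookup Q b) e≡e′)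

  -- Each of the `k` matchings has at most one edge at `a`, so colouring the edges from `a` into `Q`
  -- by a matching that contains them is injective.
  degree-matchings : ∑ (λ b → if lookup Q b then μ H a b else 0) ≤ k
  degree-matchings = injective⇒≤ {f = colour ∘ unpair g} λ {i} {j} eq →
    trans (sym (pair-unpair g i))
      (trans (cong (pair g) (colour-injective (unpair g i) (unpair g j) eq)) (pair-unpair g j))

  -- The edges from a to S already exhaust the degree that k matchings allow.
  saturated : {S : Subset m} → S ⊆ Q → (∀ {b} → b ∈ S → μ H a b ≡ t) → k ≡ ∣ S ∣ * t →
              ∀ {b} → b ∈ Q → Adjacent H a b → b ∈ S
  saturated {t = t} {S} S⊆Q onS k≡ {b} b∈Q adj with b ∈? S
  ... | yes b∈S = b∈S
  -- The edges into `S` alone, counted by `h`, number `k`; a neighbour `b` outside `S` would push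
  -- the degree above `k`.
  ... | no  b∉S = contradiction (≤-<-trans (≤-reflexive (trans k≡ (sym sum-h))) (∑-mono-< h≤g b h<g))
                                (≤⇒≯ degree-matchings)
    where
    h : Fin m → ℕ
    h x = if lookup S x then t else 0

    h-on : ∀ {x} → x ∈ S → h x ≡ t
    h-on x∈S rewrite []=⇒lookup x∈S = refl

    h-off : ∀ {x} → x ∉ S → h x ≡ 0
    h-off {x} x∉S with lookup S x in eq
    ... | true  = contradiction (lookup⇒[]= x S eq) x∉S
    ... | false = refl

    sum-h : ∑ h ≡ ∣ S ∣ * t
    sum-h = ∑-constant-on S h-on h-off

    g-on : ∀ {x} → x ∈ Q → g x ≡ μ H a x
    g-on x∈Q rewrite []=⇒lookup x∈Q = refl

    h≤g : ∀ x → h x ≤ g x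
    h≤g x with x ∈? S
    ... | yes x∈S = ≤-reflexive (trans (h-on x∈S) (trans (sym (onS x∈S)) (sym (g-on (S⊆Q x∈S)))))
    ... | no  x∉S = subst (_≤ g x) (sym (h-off x∉S)) z≤n

    h<g : h b < g b
    h<g = subst₂ _<_ (sym (h-off b∉S)) (sym (g-on b∈Q)) adj

-- Covers

fibre⊆V : {C : CoverData n m} → IsCover C → ∀ {u} → u ∈ V (G C) → X C u ⊆ V (H C)
fibre⊆V isCover u∈V x∈X = from (IsCover.union isCover _) (_ , u∈V , x∈X)

neighbour : {C : CoverData n m} → IsCover C → ∀ {u v a b} → u ∈ V (G C) → a ∈ X C u →
            Adjacent (H C [ X C u ∪ X C v ]) a b → b ∈ X C v × Adjacent (H C) a b
neighbour {C = C} isCover {u} {v} u∈V a∈ adj with Adjacent-[]⁻ (H C) adj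
... | _ , b∈ , adj′ with x∈p∪q⁻ (X C u) (X C v) b∈
...   | inj₁ b∈u = contradiction adj′ (¬Adjacent (H C) (IsCover.independent isCover u∈V a∈ b∈u))
...   | inj₂ b∈v = b∈v , adj′

module _ {C : CoverData n m} (isCover : IsCover C) {u v : Fin n}
         (u∈V : u ∈ V (G C)) (v∈V : v ∈ V (G C)) (u≢v : u ≢ v)
         (connected : OneComponent (H C [ X C u ∪ X C v ])) where
  private
    module C = IsCover isCover

    inV : ∀ {x} → x ∈ X C u ⊎ x ∈ X C v → x ∈ V (H C [ X C u ∪ X C v ])
    inV (inj₁ x∈u) = x∈p∩q⁺ (fibre⊆V isCover u∈V x∈u , x∈p∪q⁺ (inj₁ x∈u))
    inV (inj₂ x∈v) = x∈p∩q⁺ (fibre⊆V isCover v∈V x∈v , x∈p∪q⁺ (inj₂ x∈v))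

    swap : ∀ {a b} → Adjacent (H C [ X C u ∪ X C v ]) a b → Adjacent (H C [ X C v ∪ X C u ]) a b
    swap {a} {b} = subst (λ W → Adjacent (H C [ W ]) a b) (∪-comm (X C u) (X C v))

  -- S ∪ T is a union of components of H[X_u ∪ X_v].
  saturated-pair : {S T : Subset m} → S ⊆ X C u → T ⊆ X C v → Nonempty S →
    (∀ {a b} → a ∈ S → b ∈ T → μ (H C) a b ≡ t) →
    μ (G C) u v ≡ ∣ S ∣ * t → μ (G C) u v ≡ ∣ T ∣ * t → X C u ⊆ S
  saturated-pair {t = t} {S} {T} S⊆ T⊆ (a₀ , a₀∈S) onST S-sat T-sat x∈u
    with spread {K = H C [ X C u ∪ X C v ]} connected (λ x → x ∈ S ⊎ x ∈ T) closed
                (inV (inj₁ (S⊆ a₀∈S))) (inj₁ a₀∈S) (inV (inj₁ x∈u))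
    where
    closed : ∀ {x y} → x ∈ S ⊎ x ∈ T → Adjacent (H C [ X C u ∪ X C v ]) x y → y ∈ S ⊎ y ∈ T
    closed (inj₁ x∈S) adj =
      let y∈v , adj′ = neighbour isCover u∈V (S⊆ x∈S) adj in
      inj₂ (saturated (C.matchings u∈V v∈V u≢v) (S⊆ x∈S) T⊆ (onST x∈S) T-sat y∈v adj′)
    closed {x} (inj₂ x∈T) adj =
      let y∈u , adj′ = neighbour isCover v∈V (T⊆ x∈T) (swap adj) in
      inj₁ (saturated (C.matchings v∈V u∈V (u≢v ∘ sym)) (T⊆ x∈T) S⊆
              (λ y∈S → trans (symmetric (H C) x _) (onST y∈S x∈T))
              (trans (symmetric (G C) v u) S-sat) y∈u adj′)
  ... | inj₁ x∈S = x∈S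
  ... | inj₂ x∈T = contradiction (T⊆ x∈T) (C.disjoint u∈V v∈V u≢v x∈u)

  -- With no matchings available, saturation by the empty set shows that no vertex of `X C u` has a
  -- neighbour in `X C v`, so walks cannot leave `X C u`.
  connected⇒edge : Nonempty (X C u) → Nonempty (X C v) → μ (G C) u v ≢ 0
  connected⇒edge (x , x∈u) (y , y∈v) μ≡0 =
    C.disjoint u∈V v∈V u≢v
      (spread {K = H C [ X C u ∪ X C v ]} connected (_∈ X C u)
        (λ a∈u adj → let b∈v , adj′ = neighbour isCover u∈V a∈u adj in
          ⊥-elim (∉⊥ (saturated (C.matchings u∈V v∈V u≢v) a∈u {t = 0} {∅} (⊥-elim ∘ ∉⊥)
                        (⊥-elim ∘ ∉⊥) (trans μ≡0 (sym (*-zeroʳ ∣ ∅ {m} ∣))) b∈v adj′)))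
        (inV (inj₁ x∈u)) x∈u (inV (inj₂ y∈v)))
      y∈v

-- The subsets Y v of X v span in H what the fibres of an s-inflation of a
-- G-cover span.
record IsBalanced (C : CoverData n m) (Y : Fin n → Subset m) (s : ℕ) : Set where
  field
    s≥1          : 1 ≤ s
    size         : ∀ {v} → v ∈ V (G C) → ∣ Y v ∣ ≡ s
    multiplicity : ∀ {u v} → u ∈ V (G C) → v ∈ V (G C) → u ≢ v →
                   ∃[ t ] (μ (G C) u v ≡ s * t × (∀ {a b} → a ∈ Y u → b ∈ Y v → μ (H C) a b ≡ t))

module _ {C : CoverData n m} {D : CoverData n m₀} {W : Subset m} (inflation : IsInflationBy s D (C / W)) where
  open IsInflationBy inflation

  inflation⊆ : ∀ {x} → x ∈ V (H D) → U x ⊆ W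
  inflation⊆ x∈V a∈U = p∩q⊆q (V (H C)) W (from (vertices _) (_ , x∈V , a∈U))

  -- Both `U x` and `U y` lie in `W`, so passing to `C / W` keeps the edges between them; the factor
  -- `s` then cancels because it is positive.
  inflation-μ : ∀ {x y} → x ∈ V (H D) → y ∈ V (H D) → x ≢ y →
    ∃[ t ] (μ (H D) x y ≡ s * t × (∀ {a b} → a ∈ U x → b ∈ U y → μ (H C) a b ≡ t))
  inflation-μ {x} {y} x∈V y∈V x≢y with IsInflationBy.divides inflation x y
  ... | divides q eq = q , trans eq (*-comm q s) , λ {a} {b} a∈U b∈U →
    *-cancelʳ-≡ (μ (H C) a b) q s {{>-nonZero s≥1}}
      (trans (cong (_* s) (sym (μ-[]-inside (H C) (inflation⊆ x∈V a∈U) (inflation⊆ y∈V b∈U))))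
        (trans (across x∈V y∈V x≢y a∈U b∈U) eq))

-- A fibre of the G-cover is a single vertex `x v`, so the fibre over `v` in the inflation is just
-- `U (x v)`.
inflated⇒balanced : {C : CoverData n m} {W : Subset m} → IsInflatedGCover (G C) (C / W) →
                    ∃[ s ] IsBalanced C (λ v → X C v ∩ W) s
inflated⇒balanced {C = C} {W} (_ , D , (V≡ , μ≡) , (isCover , x , fibre , μx) , s , inflation) = s , record
  { s≥1          = s≥1
  ; size         = λ v∈V → trans (cong ∣_∣ (X∩W v∈V)) (size (x∈V v∈V))
  ; multiplicity = λ {u} {v} u∈V v∈V u≢v →
      let xu≢xv = λ xu≡xv → D.disjoint (inD u∈V) (inD v∈V) u≢v (x∈X u∈V)
                              (subst (_∈ X D v) (sym xu≡xv) (x∈X v∈V))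
          t , μ≡st , onU = inflation-μ {C = C} inflation (x∈V u∈V) (x∈V v∈V) xu≢xv
      in t , trans (sym (μ≡ u v)) (trans (sym (μx (inD u∈V) (inD v∈V) u≢v)) μ≡st) ,
         λ a∈ b∈ → onU (subst (_ ∈_) (X∩W u∈V) a∈) (subst (_ ∈_) (X∩W v∈V) b∈)
  }
  where
  open IsInflationBy inflation hiding (disjoint)
  module D = IsCover isCover

  inD : ∀ {v} → v ∈ V (G C) → v ∈ V (G D)
  inD = subst (_ ∈_) (sym V≡)

  x∈X : ∀ {v} → v ∈ V (G C) → x v ∈ X D v
  x∈X {v} v∈V = subst (x v ∈_) (sym (fibre (inD v∈V))) (x∈⁅x⁆ (x v))

  x∈V : ∀ {v} → v ∈ V (G C) → x v ∈ V (H D)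
  x∈V v∈V = from (D.union _) (_ , inD v∈V , x∈X v∈V)

  X∩W : ∀ {v} → v ∈ V (G C) → X C v ∩ W ≡ U (x v)
  X∩W {v} v∈V = ⊆-antisym
    (λ {a} a∈ → let y , y∈X , a∈U = to (fibres (inD v∈V) a) a∈ in
                subst (λ z → a ∈ U z) (x∈⁅y⁆⇒x≡y (x v) (subst (y ∈_) (fibre (inD v∈V)) y∈X)) a∈U)
    (λ {a} a∈U → from (fibres (inD v∈V) a) (x v , x∈X v∈V , a∈U))

module _ {C : CoverData n m} (isCover : IsCover C) {r : ℕ}
         (uniform : ∀ {v} → v ∈ V (G C) → ∣ X C v ∣ ≡ r) {u v : Fin n}
         (u∈V : u ∈ V (G C)) (v∈V : v ∈ V (G C)) (u≢v : u ≢ v)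
         (connected : OneComponent (H C [ X C u ∪ X C v ]))
         {W : Subset m} (balanced : IsBalanced C (λ v → X C v ∩ W) s) where
  open IsBalanced balanced

  -- Saturation at the connected pair gives `X C u ⊆ W`, whence `s` equals the common fibre size
  -- `r`. All intersections with `W` have size `s`, so they fill their fibres.
  balanced⇒full : ∀ {w} → w ∈ V (G C) → X C w ⊆ W
  balanced⇒full {w} w∈V = ∣∩∣≡⇒⊆ (X C w) W
    (trans (size w∈V) (trans s≡r (sym (uniform w∈V))))
    where
    Xu⊆ : X C u ⊆ X C u ∩ W
    Xu⊆ = let t , μ≡st , onW = multiplicity u∈V v∈V u≢v in
      saturated-pair isCover u∈V v∈V u≢v connected
        (p∩q⊆p (X C u) W) (p∩q⊆p (X C v) W) (Nonempty-∣∣ (size u∈V) s≥1) onW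
        (trans μ≡st (cong (_* t) (sym (size u∈V)))) (trans μ≡st (cong (_* t) (sym (size v∈V))))

    s≡r : s ≡ r
    s≡r = trans (sym (size u∈V))
      (trans (cong ∣_∣ (⊆-antisym (p∩q⊆p (X C u) W) Xu⊆)) (uniform u∈V))

  balanced⇒fibres-balanced : IsBalanced C (X C) s
  balanced⇒fibres-balanced = record
    { s≥1          = s≥1
    ; size         = λ w∈V → trans (cong ∣_∣ (sym (⊆⇒∩≡ (balanced⇒full w∈V)))) (size w∈V)
    ; multiplicity = λ w∈V z∈V w≢z → let t , μ≡st , onW = multiplicity w∈V z∈V w≢z in
        t , μ≡st , λ a∈ b∈ → onW (x∈p∩q⁺ (a∈ , balanced⇒full w∈V a∈)) (x∈p∩q⁺ (b∈ , balanced⇒full z∈V b∈))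
    }

  balanced-meet : ∀ {s′ W′} → IsBalanced C (λ v → X C v ∩ W′) s′ → ¬ Disjoint W W′
  balanced-meet {W′ = W′} balanced′ disjoint =
    let x , x∈ = Nonempty-∣∣ (IsBalanced.size balanced′ u∈V) (IsBalanced.s≥1 balanced′) in
    disjoint (balanced⇒full u∈V (p∩q⊆p (X C u) W′ x∈)) (p∩q⊆q (X C u) W′ x∈)

-- Double covers of cycles

-- The parity of the quotient of `z` by `k` decides the case: an odd quotient becomes even after one
-- `k` is subtracted.
∣-halve : ∀ (k z : ℤ) → k ∣ˢ z → (k ℤ.+ k) ∣ˢ z ⊎ (k ℤ.+ k) ∣ˢ (z ℤ.- k)
∣-halve k z (dividesˢ q z≡qk) with q %ℕ 2 | a≡a%ℕn+[a/ℕn]*n q 2 | n%ℕd<d q 2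
... | 0 | q≡ | _ = inj₁ (dividesˢ (q /ℕ 2) (trans z≡qk (trans (cong (ℤ._* k) q≡) (even (q /ℕ 2) k))))
  where
  even : ∀ h k → (ℤ.0ℤ ℤ.+ h ℤ.* (ℤ.+ 2)) ℤ.* k ≡ h ℤ.* (k ℤ.+ k)
  even = solve-∀
... | 1 | q≡ | _ = inj₂ (dividesˢ (q /ℕ 2)
                     (trans (cong (ℤ._- k) (trans z≡qk (cong (ℤ._* k) q≡))) (odd (q /ℕ 2) k)))
  where
  odd : ∀ h k → (ℤ.1ℤ ℤ.+ h ℤ.* (ℤ.+ 2)) ℤ.* k ℤ.- k ≡ h ℤ.* (k ℤ.+ k)
  odd = solve-∀
... | suc (suc _) | _ | s≤s (s≤s ())

⊖-shift : ∀ i k j e → (i ⊖ j ℤ.+ e) ℤ.- ℤ.+ k ≡ i ⊖ (k + j) ℤ.+ e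
⊖-shift i k j e = trans (cong (λ d → (d ℤ.+ e) ℤ.- ℤ.+ k) (sym ([+m]-[+n]≡m⊖n i j)))
  (trans (rearrange (ℤ.+ i) (ℤ.+ j) (ℤ.+ k) e) (cong (ℤ._+ e) ([+m]-[+n]≡m⊖n i (k + j))))
  where
  rearrange : ∀ i j k e → ((i ℤ.- j) ℤ.+ e) ℤ.- k ≡ (i ℤ.- (k ℤ.+ j)) ℤ.+ e
  rearrange = solve-∀

-- A congruence modulo `k` lifts to modulus `k + k` for `j` or for `k + j`, so the lower copy of `i`
-- is next to one of the two copies of `j` in the double cover.
cyclic-lift : ∀ k i j → CyclicNeighbours k i j →
              CyclicNeighbours (k + k) (i ↑ˡ k) (j ↑ˡ k) ⊎ CyclicNeighbours (k + k) (i ↑ˡ k) (k ↑ʳ j)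
cyclic-lift k i j rewrite toℕ-↑ˡ i k | toℕ-↑ˡ j k | toℕ-↑ʳ k j = λ
  -- Subtracting `1ℤ` unfolds to adding `-1ℤ`, so `lift` handles both signs.
  { (inj₁ k∣) → Sum.map inj₁ inj₁ (lift ℤ.-1ℤ k∣)
  ; (inj₂ k∣) → Sum.map inj₂ inj₂ (lift ℤ.1ℤ k∣)
  }
  where
  lift : ∀ e → (ℤ.+ k) ∣ᵤ (toℕ i ⊖ toℕ j ℤ.+ e) →
         (ℤ.+ (k + k)) ∣ᵤ (toℕ i ⊖ toℕ j ℤ.+ e) ⊎ (ℤ.+ (k + k)) ∣ᵤ (toℕ i ⊖ (k + toℕ j) ℤ.+ e)
  lift e k∣ = Sum.map ∣⇒∣ᵤ (λ 2k∣ → ∣⇒∣ᵤ (subst ((ℤ.+ (k + k)) ∣ˢ_) (⊖-shift (toℕ i) k (toℕ j) e) 2k∣))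
                (∣-halve (ℤ.+ k) (toℕ i ⊖ toℕ j ℤ.+ e) (∣ᵤ⇒∣ k∣))

module _ {C : CoverData n m} (isCover : IsCover C) {W : Subset m} where

  -- For adjacent vertices of the cycle, an inflated edge of the double cover is
  -- already a component of H[X_u ∪ X_v], and it misses half of X_u ∩ W.
  inflatedDoubleCover⇒disconnected : IsInflatedDoubleCover t k (G C) (C / W) →
    ∀ {u v} → u ∈ V (G C) → v ∈ V (G C) → u ≢ v → ¬ OneComponent (H C [ X C u ∪ X C v ])
  inflatedDoubleCover⇒disconnected {t} {k} (_ , D , (V≡ , μ≡) , double , s , inflation)
    {u} {v} u∈V v∈V u≢v connected =
    contra (to (cycle.vertices u) (inD u∈V)) (to (cycle.vertices v) (inD v∈V))
    where
    open IsInflationBy inflation hiding (vertices)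
    module D = IsDoubleCover double
    module cycle = CyclicEnumeration D.cycle
    module isCover = IsCover D.isCover
    open cycle using (c)

    inD : ∀ {w} → w ∈ V (G C) → w ∈ V (G D)
    inD = subst (_ ∈_) (sym V≡)

    low∈X : ∀ i → D.x (i ↑ˡ k) ∈ X D (c i)
    low∈X i = subst (_ ∈_) (sym (D.fibre i)) (x∈p∪q⁺ (inj₁ (x∈⁅x⁆ _)))

    high∈X : ∀ i → D.x (k ↑ʳ i) ∈ X D (c i)
    high∈X i = subst (_ ∈_) (sym (D.fibre i)) (x∈p∪q⁺ (inj₂ (x∈⁅x⁆ _)))

    high≢low : ∀ i → D.x (k ↑ʳ i) ≢ D.x (i ↑ˡ k)
    high≢low i eq = <⇒≢ (<-≤-trans (toℕ<n i) (m≤m+n k (toℕ i)))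
      (trans (sym (toℕ-↑ˡ i k)) (trans (cong toℕ (sym (D.injective eq))) (toℕ-↑ʳ k i)))

    contra : ∃[ i ] u ≡ c i → ∃[ j ] v ≡ c j → ⊥
    contra (i , refl) (j , refl) =
      -- Connectedness forces an edge between `u` and `v`, so it suffices to refute that `i` and `j`
      -- are cyclic neighbours.
      connected⇒edge isCover u∈V v∈V u≢v connected
        (nonempty⊆ u∈V (low∈X i)) (nonempty⊆ v∈V (low∈X j))
        (trans (sym (μ≡ (c i) (c j))) (cycle.nonadjacent i j neighbours⇒⊥))
      where
      x∈V : ∀ {w y} → w ∈ V (G C) → y ∈ X D w → y ∈ V (H D)
      x∈V w∈V y∈X = from (isCover.union _) (_ , inD w∈V , y∈X)

      U⊆X : ∀ {w y} → w ∈ V (G C) → y ∈ X D w → U y ⊆ X C w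
      U⊆X {w} w∈V y∈X {a} a∈U = p∩q⊆p (X C w) W (from (fibres (inD w∈V) a) (_ , y∈X , a∈U))

      nonempty⊆ : ∀ {w y} → w ∈ V (G C) → y ∈ X D w → Nonempty (X C w)
      nonempty⊆ w∈V y∈X = let a , a∈U = Nonempty-∣∣ (size (x∈V w∈V y∈X)) s≥1 in a , U⊆X w∈V y∈X a∈U

      -- Both the cycle edge and the lifted edge have multiplicity `t`, so the inflated edge is
      -- saturated and the set replacing the lower vertex would be all of `X C u`. It misses the
      -- nonempty set that replaces the upper vertex.
      edge⇒⊥ : CyclicNeighbours k i j → ∀ j′ → D.x j′ ∈ X D (c j) →
               CyclicNeighbours (k + k) (i ↑ˡ k) j′ → ⊥
      edge⇒⊥ near j′ xj∈X near′ = disjoint high∈V low∈V (high≢low i) a∈U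
        (saturated-pair isCover u∈V v∈V u≢v connected
          (U⊆X u∈V (low∈X i)) (U⊆X v∈V xj∈X) (Nonempty-∣∣ (size low∈V) s≥1) onU
          (trans μ≡sq (cong (_* q) (sym (size low∈V)))) (trans μ≡sq (cong (_* q) (sym (size xj∈V))))
          (U⊆X u∈V (high∈X i) a∈U))
        where
        low∈V  = x∈V u∈V (low∈X i)
        high∈V = x∈V u∈V (high∈X i)
        xj∈V   = x∈V v∈V xj∈X

        a∈U = proj₂ (Nonempty-∣∣ (size high∈V) s≥1)

        low≢xj : D.x (i ↑ˡ k) ≢ D.x j′
        low≢xj eq = isCover.disjoint (inD u∈V) (inD v∈V) u≢v (low∈X i)
                      (subst (_∈ X D (c j)) (sym eq) xj∈X)

        block-μ = inflation-μ {C = C} inflation low∈V xj∈V low≢xj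
        q       = proj₁ block-μ
        onU     = proj₂ (proj₂ block-μ)

        μ≡sq : μ (G C) (c i) (c j) ≡ s * q
        μ≡sq = trans (sym (μ≡ (c i) (c j)))
          (trans (cycle.adjacent i j near)
            (trans (sym (D.adjacent (i ↑ˡ k) j′ near′)) (proj₁ (proj₂ block-μ))))

      neighbours⇒⊥ : ¬ CyclicNeighbours k i j
      neighbours⇒⊥ near with cyclic-lift k i j near
      ... | inj₁ near′ = edge⇒⊥ near (j ↑ˡ k) (low∈X j) near′
      ... | inj₂ near′ = edge⇒⊥ near (k ↑ʳ j) (high∈X j) near′

-- Configurations

degree-multipleComplete : {K : Graph n} → IsMultipleComplete t (suc k) K →
                          ∀ {v} → v ∈ V K → degree K v ≡ t * k
degree-multipleComplete {t = t} {k} {K} (size , complete) {v} v∈V =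
  trans (+-cancelˡ-≡ t (degree K v) (k * t)
    (trans (∑-constant-on-but v∈V (loopless K v)
             (λ x∈V x≢v → complete v∈V x∈V (x≢v ∘ sym))
             (λ {x} x∉V → trans (symmetric K v x) (supported K x v x∉V)))
           (cong (_* t) size)))
    (*-comm k t)

module _ {𝔠 : ConfigurationData n m} (isBlock : IsBlock (G (cover 𝔠))) {u v : Fin n}
         (u∈V : u ∈ V (G (cover 𝔠))) (v∈V : v ∈ V (G (cover 𝔠))) (u≢v : u ≢ v)
         (connected : OneComponent (H (cover 𝔠) [ X (cover 𝔠) u ∪ X (cover 𝔠) v ])) where
  private
    C = cover 𝔠

    module Uniform (isUniform : IsUniformConfiguration 𝔠) where
      open IsUniformConfiguration isUniform

      fibres-balanced : ∀ {W} → IsInflatedGCover (G C) (C / W) → ∃[ s ] IsBalanced C (X C) s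
      fibres-balanced inflated = let s , balanced = inflated⇒balanced inflated in
        s , balanced⇒fibres-balanced isCover uniform u∈V v∈V u≢v connected balanced

      meet : ∀ {W W′} → IsInflatedGCover (G C) (C / W) → IsInflatedGCover (G C) (C / W′) → ¬ Disjoint W W′
      meet inflated inflated′ = balanced-meet isCover uniform u∈V v∈V u≢v connected
        (proj₂ (inflated⇒balanced inflated)) (proj₂ (inflated⇒balanced inflated′))

    K⇒M : IsKConfiguration 𝔠 → IsMConfiguration 𝔠 × ∃[ s ] IsBalanced C (X C) s
    K⇒M record { p = zero ; p≥1 = () }
    K⇒M record { isUniform = isUniform ; p = suc (suc _) ; disjoint = disjoint ; inflation = inflation } =
      ⊥-elim (Uniform.meet isUniform (inflation zero) (inflation (suc zero))
               (disjoint zero (suc zero) (λ ())))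
    K⇒M record { isUniform = isUniform ; t = t ; k = suc k ; complete = complete ; p = suc zero
               ; part = part ; sum-part = sum-part ; U = U ; U⊆V = U⊆V
               ; inflation = inflation ; f-on = f-on ; f-off = f-off } =
      record
        { isUniform = isUniform
        ; isBlock   = isBlock
        ; U         = U zero
        ; U⊆V       = U⊆V zero
        ; inflation = inflation zero
        ; f-on      = λ v∈V x∈X x∈U → trans (f-on zero v∈V x∈X x∈U)
                        -- For one part, `∑ part` unfolds to `part zero + 0`, which is the order
                        -- less one; hence the prescribed value is the degree.
                        (trans (cong (t *_) (trans (sym (+-identityʳ (part zero))) sum-part))
                               (sym (degree-multipleComplete {K = G C} complete v∈V)))
        ; f-off     = λ x∈V x∉U → f-off x∈V (λ { zero → x∉U })
        } ,
      Uniform.fibres-balanced isUniform (inflation zero)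

  -- Balance of the whole fibres is returned as well, since it supplies the bicliques over the other
  -- pairs of vertices.
  MKC-connected⇒M : IsMKCConfiguration 𝔠 → IsMConfiguration 𝔠 × ∃[ s ] IsBalanced C (X C) s
  MKC-connected⇒M (M-conf M)  = M , Uniform.fibres-balanced isUniform inflation
    where open IsMConfiguration M
  MKC-connected⇒M (K-conf K)  = K⇒M K
  MKC-connected⇒M (Cᵒ-conf O) = ⊥-elim (Uniform.meet isUniform inflation₁ inflation₂ disjoint)
    where open IsOddCConfiguration O
  MKC-connected⇒M (Cᵉ-conf E) =
    ⊥-elim (inflatedDoubleCover⇒disconnected (IsUniformConfiguration.isCover isUniform)
              inflation u∈V v∈V u≢v connected)
    where open IsEvenCConfiguration E

-- The relation `≈` compares multiplicities pointwise, so data mentioning them must be rewritten,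
-- while data mentioning only vertices carries over once the vertex sets are identified.
IsMConfiguration-resp-≈ : (C : CoverData n m) {A B : Graph n} {g g′ : Fin m → ℕ} → A ≈ B → IsBlock B →
  (∀ {x} → x ∈ V (H (restrict C B)) → g′ x ≡ g x) →
  IsMConfiguration (restrict C A , g) → IsMConfiguration (restrict C B , g′)
-- The record patterns expose the vertex sets as variables, which lets `refl` unify them.
IsMConfiguration-resp-≈ C {A@record{}} {B@record{}} (refl , μ≡) isBlockB g≡ M = record
  { isUniform = record
      { isCover = record
          { disjoint    = Cover.disjoint
          ; union       = Cover.union
          ; independent = Cover.independent
          ; matchings   = λ {u} {v} u∈V v∈V u≢v →
              subst (UnionOfMatchings _ (X C u) (X C v)) (μ≡ u v) (Cover.matchings u∈V v∈V u≢v)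
          }
      ; r       = Uniform.r
      ; r≥1     = Uniform.r≥1
      ; uniform = Uniform.uniform
      }
  ; isBlock   = isBlockB
  ; U         = U
  ; U⊆V       = U⊆V
  ; inflation = inflation′
  ; f-on      = λ {v} {x} v∈V x∈X x∈U →
      trans (cong (_* ∣ X C v ∩ U ∣) (g≡ (U⊆V x∈U)))
        (trans (f-on v∈V x∈X x∈U) (sum-cong-≗ (μ≡ v)))
  ; f-off     = λ x∈V x∉U → trans (g≡ x∈V) (f-off x∈V x∉U)
  }
  where
  open IsMConfiguration M
  module Uniform = IsUniformConfiguration isUniform
  module Cover = IsCover Uniform.isCover

  inflation′ : IsInflatedGCover B (restrict C B / U)
  inflation′ with inflation
  ... | m₀ , D , D≈A , isGCover , s , isInflation =
    m₀ , D , ≈-trans {K = G D} {A} {B} D≈A (refl , μ≡) , isGCover , s , record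
      { s≥1      = s≥1
      ; divides  = IsInflationBy.divides isInflation
      ; sameBase = ≈-trans {K = G (restrict C B / U)} {G (restrict C A / U)} {G D}
                     (≈-sym {K = G (restrict C A / U)} {G (restrict C B / U)} (≈-[] {K = A} {B} _ (refl , μ≡)))
                     sameBase
      ; U        = IsInflationBy.U isInflation
      ; size     = size
      ; disjoint = disjoint
      ; vertices = vertices
      ; fibres   = fibres
      ; across   = across
      ; inside   = IsInflationBy.inside isInflation
      }
    where open IsInflationBy isInflation hiding (U)

proposition10 : ∀ {n m : ℕ} (𝔠 : ConfigurationData n m) → Constructible 𝔠 →
    let C = cover 𝔠 in
    (B : Graph n) → B IsBlockOf G C →
    (fᴮ : Fin m → ℕ) → IsBlockPart 𝔠 B fᴮ →
    (∃[ u ] ∃[ v ] (u ∈ V B × v ∈ V B × u ≢ v × OneComponent (H C [ X C u ∪ X C v ]))) →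
    IsMConfiguration (restrict C B , fᴮ) ×
    (∀ u v → u ∈ V B → v ∈ V B → u ≢ v → ∀ k → μ (G C) u v ≡ k → 0 < k →
    ∃[ s ] ∃[ t ] (1 ≤ s × 1 ≤ t × k ≡ t * s × IsMultipleBiclique t s (H C [ X C u ∪ X C v ])))
proposition10 {n} {m} 𝔠 _ B B-block fᴮ (_ , block , part , decomposition , i , A≈B , fᴮ≡)
  (u₀ , v₀ , u₀∈B , v₀∈B , u₀≢v₀ , (x₀ , x₀∈) , joined) =
  IsMConfiguration-resp-≈ C {A} {B} A≈B (block⇒IsBlock B-block) fᴮ≡ (proj₁ A-M) , biclique
  where
  open IsBlockDecomposition decomposition
  C = cover 𝔠
  -- The argument runs over the listed block `A`, whose part is known to be of type M, K or C; the
  -- M-configuration is carried over to `B` at the end.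
  A = block i
  R = restrict C A

  inA : ∀ {w} → w ∈ V B → w ∈ V A
  inA = subst (_ ∈_) (sym (proj₁ A≈B))

  A-cover : IsCover R
  A-cover = MKC-cover (partKind i)
    where
    MKC-cover : ∀ {𝔡 : ConfigurationData n m} → IsMKCConfiguration 𝔡 → IsCover (cover 𝔡)
    MKC-cover (M-conf c)  = IsUniformConfiguration.isCover (IsMConfiguration.isUniform c)
    MKC-cover (K-conf c)  = IsUniformConfiguration.isCover (IsKConfiguration.isUniform c)
    MKC-cover (Cᵒ-conf c) = IsUniformConfiguration.isCover (IsOddCConfiguration.isUniform c)
    MKC-cover (Cᵉ-conf c) = IsUniformConfiguration.isCover (IsEvenCConfiguration.isUniform c)

  module _ {u v : Fin n} (u∈B : u ∈ V B) (v∈B : v ∈ V B) where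

    pair⊆HR : X C u ∪ X C v ⊆ V (H R)
    pair⊆HR x∈ with x∈p∪q⁻ (X C u) (X C v) x∈
    ... | inj₁ x∈u = fibre⊆V A-cover (inA u∈B) x∈u
    ... | inj₂ x∈v = fibre⊆V A-cover (inA v∈B) x∈v

    μ-HR : ∀ {x y} → x ∈ X C u ∪ X C v → y ∈ X C u ∪ X C v → μ (H R) x y ≡ μ (H C) x y
    μ-HR x∈ y∈ = μ-[]-inside (H C) (p∩q⊆q (V (H C)) _ (pair⊆HR x∈)) (p∩q⊆q (V (H C)) _ (pair⊆HR y∈))

  -- Both fibres lie over the block, so restricting `H C` to the fibres over it changes nothing
  -- between them.
  connected : OneComponent (H R [ X C u₀ ∪ X C v₀ ])
  connected = (x₀ , x∈p∩q⁺ (pair⊆HR u₀∈B v₀∈B x₀∈pair , x₀∈pair)) ,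
              λ x∈ y∈ → Star.map adjacent (joined (inHC x∈) (inHC y∈))
    where
    x₀∈pair : x₀ ∈ X C u₀ ∪ X C v₀
    x₀∈pair = p∩q⊆q (V (H C)) _ x₀∈

    inHC : ∀ {x} → x ∈ V (H R [ X C u₀ ∪ X C v₀ ]) → x ∈ V (H C [ X C u₀ ∪ X C v₀ ])
    inHC x∈ = let x∈R , x∈pair = x∈p∩q⁻ (V (H R)) _ x∈ in x∈p∩q⁺ (p∩q⊆p (V (H C)) _ x∈R , x∈pair)

    adjacent : ∀ {x y} → Adjacent (H C [ X C u₀ ∪ X C v₀ ]) x y → Adjacent (H R [ X C u₀ ∪ X C v₀ ]) x y
    adjacent adj = let x∈ , y∈ , adj′ = Adjacent-[]⁻ (H C) adj in
      Adjacent-[]⁺ (H R) x∈ y∈ (subst (0 <_) (sym (μ-HR u₀∈B v₀∈B x∈ y∈)) adj′)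

  A-M : IsMConfiguration (R , part i) × ∃[ s ] IsBalanced R (X R) s
  A-M = MKC-connected⇒M (block⇒IsBlock (isBlock i)) (inA u₀∈B) (inA v₀∈B) u₀≢v₀ connected (partKind i)

  biclique : ∀ u v → u ∈ V B → v ∈ V B → u ≢ v → ∀ k → μ (G C) u v ≡ k → 0 < k →
             ∃[ s ] ∃[ t ] (1 ≤ s × 1 ≤ t × k ≡ t * s × IsMultipleBiclique t s (H C [ X C u ∪ X C v ]))
  biclique u v u∈B v∈B u≢v k refl 0<k = s₀ , t₀ , s≥1 , n≢0⇒n>0 t≢0 , μ≡ts , record
    { P        = X C u
    ; Q        = X C v
    ; disjoint = Cover.disjoint (inA u∈B) (inA v∈B) u≢v
    ; union    = ⊆-antisym (p∩q⊆q (V (H C)) _)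
                   (λ x∈ → x∈p∩q⁺ (p∩q⊆p (V (H C)) _ (pair⊆HR u∈B v∈B x∈) , x∈))
    ; ∣P∣≡s    = size (inA u∈B)
    ; ∣Q∣≡s    = size (inA v∈B)
    ; across   = λ x∈ y∈ → μ-pair (inj₁ x∈) (inj₂ y∈) (onX x∈ y∈)
    ; insideP  = λ x∈ y∈ → μ-pair (inj₁ x∈) (inj₁ y∈) (Cover.independent (inA u∈B) x∈ y∈)
    ; insideQ  = λ x∈ y∈ → μ-pair (inj₂ x∈) (inj₂ y∈) (Cover.independent (inA v∈B) x∈ y∈)
    }
    where
    module Cover = IsCover A-cover
    s₀  = proj₁ (proj₂ A-M)
    open IsBalanced (proj₂ (proj₂ A-M))
    t₀  = proj₁ (multiplicity (inA u∈B) (inA v∈B) u≢v)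
    onX = proj₂ (proj₂ (multiplicity (inA u∈B) (inA v∈B) u≢v))

    μ≡ts : μ (G C) u v ≡ t₀ * s₀
    -- Balance concerns multiplicities in `A`; these agree with those in `G C` because a block is an
    -- induced subgraph.
    μ≡ts = trans (sym (block-induced (isBlock i) (inA u∈B) (inA v∈B)))
      (trans (proj₁ (proj₂ (multiplicity (inA u∈B) (inA v∈B) u≢v))) (*-comm s₀ t₀))

    t≢0 : t₀ ≢ 0
    t≢0 t≡0 = <⇒≢ 0<k (sym (trans μ≡ts (cong (_* s₀) t≡0)))

    μ-pair : ∀ {x y j} → x ∈ X C u ⊎ x ∈ X C v → y ∈ X C u ⊎ y ∈ X C v →
             μ (H R) x y ≡ j → μ (H C [ X C u ∪ X C v ]) x y ≡ j
    μ-pair x∈ y∈ eq = trans (μ-[]-inside (H C) (x∈p∪q⁺ x∈) (x∈p∪q⁺ y∈))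
      (trans (sym (μ-HR u∈B v∈B (x∈p∪q⁺ x∈) (x∈p∪q⁺ y∈))) eq)
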